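{- Let $d$, $n$, $a$ be positive integers with $a < \frac{d+3}{2}$. Then $$h_d^{(a)}(n) \leq \ell_d^{(a)}(n).$$
   Context: A partition $\pi$ is a finite nonempty nonincreasing sequence of positive integers, called its parts. Its perimeter is (largest part of $\pi$) $+$ (number of parts of $\pi$) $-\,1$. A partition is $d$-distinct if any two consecutive parts $\pi_i\ge \pi_{i+1}$ satisfy $\pi_i-\pi_{i+1}\geq d$. For positive integers $n,a,d$: - $h_d^{(a)}(n)$ is the number of partitions with perimeter $n$ whose parts are $d$-distinct and all $\geq a$; - $\ell_d^{(a)}(n)$ is the number of partitions with perimeter $n$ all of whose parts are congruent to $a$ or $-a$ modulo $d+3$. -}

module Defs where

open import Data.Integer.Base as ℤ using (ℤ; ∣_∣)
import Data.Integer.Divisibility as ℤ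
open import Data.List.Base as List using (List; []; _∷_; cartesianProductWith; filter; upTo)
open import Data.List.Membership.Propositional using (_∈_)
open import Data.List.Membership.Propositional.Properties
  using (∈-cartesianProductWith⁺; ∈-cartesianProductWith⁻; ∈-upTo⁺; ∈-filter⁺; ∈-filter⁻)
open import Data.List.NonEmpty.Base using (List⁺; _∷_; foldr₁; length; toList)
open import Data.List.Relation.Unary.All as All using (All; []; _∷_; all?)
open import Data.List.Relation.Unary.AllPairs using ([]; _∷_)
open import Data.List.Relation.Unary.Any using (here; there)
open import Data.List.Relation.Unary.Linked using (Linked; linked?)
open import Data.List.Relation.Unary.Unique.Propositional using (Unique)
open import Data.List.Relation.Unary.Unique.Propositional.Properties
  using (cartesianProductWith⁺; filter⁺; upTo⁺)
open import Data.Nat.Base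
open import Data.Nat.Divisibility using (_∣?_)
open import Data.Nat.Properties
open import Data.Product.Base using (_×_; _,_; proj₂)
open import Data.Sum.Base using (_⊎_)
open import Function.Base using (_∘_)
open import Function.Bundles using (_⇔_; mk⇔)
open import Relation.Binary.PropositionalEquality using (_≡_; _≢_; refl; cong; sym)
open import Relation.Nullary.Decidable using (_×-dec_; _⊎-dec_)
open import Relation.Unary using (Pred; Decidable)
open import Level using (0ℓ)

IsPartition : Pred (List⁺ ℕ) 0ℓ
IsPartition π = Linked _≥_ (toList π) × All (0 <_) (toList π)

largestPart : List⁺ ℕ → ℕ
largestPart = foldr₁ _⊔_

perimeter : List⁺ ℕ → ℕ
perimeter π = largestPart π + length π ∸ 1

-- On a nonincreasing list the truncated subtraction is the true difference.
Distinct : ℕ → Pred (List⁺ ℕ) 0ℓ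
Distinct d π = Linked (λ x y → x ∸ y ≥ d) (toList π)

PartsAtLeast : ℕ → Pred (List⁺ ℕ) 0ℓ
PartsAtLeast a π = All (a ≤_) (toList π)

infix 4 _≡_[mod_]

_≡_[mod_] : ℤ → ℤ → ℕ → Set
x ≡ y [mod m ] = ℤ.+ m ℤ.∣ x ℤ.- y

PartsCongruent± : ℕ → ℕ → Pred (List⁺ ℕ) 0ℓ
PartsCongruent± a m π =
  All (λ x → (ℤ.+ x ≡ ℤ.+ a [mod m ]) ⊎ (ℤ.+ x ≡ ℤ.- (ℤ.+ a) [mod m ])) (toList π)

isPartition? : Decidable IsPartition
isPartition? π = linked? _≥?_ (toList π) ×-dec all? (0 <?_) (toList π)

distinct? : ∀ d → Decidable (Distinct d)
distinct? d = linked? (λ x y → x ∸ y ≥? d) ∘ toList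

partsAtLeast? : ∀ a → Decidable (PartsAtLeast a)
partsAtLeast? a = all? (a ≤?_) ∘ toList

partsCongruent±? : ∀ a m → Decidable (PartsCongruent± a m)
partsCongruent±? a m =
  all? (λ x → (m ∣? ∣ ℤ.+ x ℤ.- ℤ.+ a ∣) ⊎-dec (m ∣? ∣ ℤ.+ x ℤ.- (ℤ.- (ℤ.+ a)) ∣)) ∘ toList

-- Lists of length at most k with entries from xs.
listsUpTo : List ℕ → ℕ → List (List ℕ)
listsUpTo xs zero    = [] ∷ []
listsUpTo xs (suc k) = [] ∷ cartesianProductWith _∷_ xs (listsUpTo xs k)

-- A partition of perimeter n has at most n parts, each of size at most n.
candidates : ℕ → List (List⁺ ℕ)
candidates n = cartesianProductWith _∷_ (upTo (suc n)) (listsUpTo (upTo (suc n)) n)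

-- Every partition of perimeter n exactly once; see ∈-partitions and
-- partitions-unique below.
partitions : ℕ → List (List⁺ ℕ)
partitions n = filter (λ π → isPartition? π ×-dec perimeter π ≟ n) (candidates n)

h : (d a n : ℕ) → ℕ
h d a n = List.length (filter (λ π → distinct? d π ×-dec partsAtLeast? a π) (partitions n))

ℓ : (d a n : ℕ) → ℕ
ℓ d a n = List.length (filter (partsCongruent±? a (d + 3)) (partitions n))

listsUpTo-unique : ∀ {xs} k → Unique xs → Unique (listsUpTo xs k)
listsUpTo-unique zero    u = [] ∷ []
listsUpTo-unique {xs} (suc k) u =
  All.tabulate []≢ ∷ cartesianProductWith⁺ _∷_ (λ { refl → refl , refl }) u (listsUpTo-unique k u)
  where
  []≢ : ∀ {ys} → ys ∈ cartesianProductWith _∷_ xs (listsUpTo xs k) → [] ≢ ys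
  []≢ ys∈ refl with ∈-cartesianProductWith⁻ _∷_ xs (listsUpTo xs k) ys∈
  ... | _ , _ , _ , _ , ()

∈-listsUpTo : ∀ {xs ys k} → List.length ys ≤ k → All (_∈ xs) ys → ys ∈ listsUpTo xs k
∈-listsUpTo {k = zero}  z≤n     []         = here refl
∈-listsUpTo {k = suc k} z≤n     []         = here refl
∈-listsUpTo {k = suc k} (s≤s l) (y∈ ∷ ys∈) =
  there (∈-cartesianProductWith⁺ _∷_ y∈ (∈-listsUpTo l ys∈))

parts≤largestPart : ∀ π → All (_≤ largestPart π) (toList π)
parts≤largestPart (x ∷ xs) = go x xs
  where
  go : ∀ x xs → All (_≤ largestPart (x ∷ xs)) (x ∷ xs)
  go x []       = ≤-refl ∷ []
  go x (y ∷ ys) = m≤m⊔n x _ ∷ All.map (λ p → ≤-trans p (m≤n⊔m x _)) (go y ys)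

∈-candidates : ∀ π → IsPartition π → π ∈ candidates (perimeter π)
∈-candidates π@(x ∷ xs) (_ , pos) with parts≤largestPart π
... | x≤ ∷ xs≤ =
  ∈-cartesianProductWith⁺ _∷_ (bound x≤) (∈-listsUpTo len≤ (All.map bound xs≤))
  where
  perimeter≡ : perimeter π ≡ largestPart π + List.length xs
  perimeter≡ = cong (_∸ 1) (+-suc (largestPart π) (List.length xs))

  bound : ∀ {y} → y ≤ largestPart π → y ∈ upTo (suc (perimeter π))
  bound y≤ = ∈-upTo⁺ (s≤s (≤-trans y≤ (≤-trans (m≤m+n _ _) (≤-reflexive (sym perimeter≡)))))

  len≤ : List.length xs ≤ perimeter π
  len≤ = ≤-trans (m≤n+m _ (largestPart π)) (≤-reflexive (sym perimeter≡))

∈-partitions : ∀ {n π} → π ∈ partitions n ⇔ (IsPartition π × perimeter π ≡ n)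
∈-partitions {n} {π} = mk⇔
  (proj₂ ∘ ∈-filter⁻ (λ ρ → isPartition? ρ ×-dec perimeter ρ ≟ n) {xs = candidates n})
  (λ { (p , refl) → ∈-filter⁺ (λ ρ → isPartition? ρ ×-dec perimeter ρ ≟ n)
                              (∈-candidates π p) (p , refl) })

partitions-unique : ∀ n → Unique (partitions n)
partitions-unique n = filter⁺ (λ ρ → isPartition? ρ ×-dec perimeter ρ ≟ n)
  (cartesianProductWith⁺ _∷_ (λ { refl → refl , refl }) (upTo⁺ (suc n))
    (listsUpTo-unique n (upTo⁺ (suc n))))

{-# OPTIONS --safe #-}
-- Removing the forced part of each gap turns a d-distinct partition with k parts
-- ≥ a into an arbitrary sequence of excesses e₁, …, e_k, listed from the smallest
-- part.  Let s₁ = a < s₂ = d + 3 − a < s₃ = d + 3 + a < ⋯ be the numbers congruent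
-- to ±a modulo d + 3.  Send the partition to the one with largest part s_k in which
-- s_j occurs e_j times for odd j < k and e_j + d − 1 times for even j < k, and s_k
-- occurs 1 + e_k times (k odd) or 1 + e_k + 2a − 2 times (k even).  Since s_{j+2} −
-- s_j + (d − 1) = 2 (d + 1), this preserves the perimeter; it is injective because
-- k and then the excesses can be read off the image.
module Submission where

open import Defs
open import Data.Nat.Base using (ℕ; zero; suc; _+_; _*_; _∸_; _⊔_; _<_; _≤_; _≥_; z≤n; s≤s)
open import Data.Nat.Properties
open import Data.Nat.Divisibility using (divides)
open import Data.Nat.Tactic.RingSolver using (solve-∀)
open import Data.Fin.Base using (zero; suc)
open import Data.Fin.Properties using (injective⇒≤)
open import Data.Integer.Base as ℤ using (∣_∣; _⊖_)
import Data.Integer.Properties as ℤ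
open import Data.List.Base as List using (List; []; _∷_; _++_; length; replicate; lookup)
open import Data.List.Membership.Propositional using (_∈_)
open import Data.List.Membership.Propositional.Properties using (∈-filter⁺; ∈-filter⁻; ∈-lookup)
open import Data.List.Membership.Setoid.Properties using (index-injective)
open import Data.List.NonEmpty.Base using (List⁺; _∷_; toList)
open import Data.List.Properties using (length-++; length-replicate; ∷-injectiveˡ; ∷-injectiveʳ)
open import Data.List.Relation.Unary.All as All using (All; []; _∷_)
open import Data.List.Relation.Unary.All.Properties using (++⁺; replicate⁺)
open import Data.List.Relation.Unary.AllPairs using (AllPairs; []; _∷_)
open import Data.List.Relation.Unary.Any using (index)
open import Data.List.Relation.Unary.Linked using (Linked; [-]; _∷_)
open import Data.List.Relation.Unary.Linked.Properties using (AllPairs⇒Linked)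
open import Data.List.Relation.Unary.Unique.Propositional using (Unique)
open import Data.List.Relation.Unary.Unique.Propositional.Properties using (filter⁺)
open import Data.Product.Base using (∃; _×_; _,_; map₁)
open import Data.Sum.Base using (_⊎_; inj₁; inj₂)
open import Function.Bundles using (Equivalence)
open import Relation.Binary.Definitions using (tri<; tri≈; tri>)
open import Relation.Binary.PropositionalEquality
open import Relation.Nullary.Decidable using (_×-dec_)
open import Relation.Nullary.Negation using (contradiction)

-- Comparing lengths of lists through an injection.

module _ {A : Set} where

  lookup-injective : {xs : List A} → Unique xs → ∀ {i j} → lookup xs i ≡ lookup xs j → i ≡ j
  lookup-injective (_  ∷ _) {zero}  {zero}  _  = refl
  lookup-injective (x∉ ∷ _) {zero}  {suc j} eq = contradiction eq (All.lookup x∉ (∈-lookup j))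
  lookup-injective (x∉ ∷ _) {suc i} {zero}  eq = contradiction (sym eq) (All.lookup x∉ (∈-lookup i))
  lookup-injective (_  ∷ u) {suc i} {suc j} eq = cong suc (lookup-injective u eq)

  -- Sending a position in `xs` to the position of its image in `ys` is an injection between the two
  -- index sets: equal positions hold equal images, hence equal entries of `xs`, and uniqueness
  -- makes their positions equal.
  length-≤-injection : {B : Set} {xs : List A} {ys : List B} (f : A → B) → Unique xs →
    (∀ {x} → x ∈ xs → f x ∈ ys) →
    (∀ {x y} → x ∈ xs → y ∈ xs → f x ≡ f y → x ≡ y) →
    length xs ≤ length ys
  length-≤-injection f unique into injective = injective⇒≤ {f = λ i → index (into (∈-lookup i))}
    (λ eq → lookup-injective unique (injective (∈-lookup _) (∈-lookup _)
      (index-injective (setoid _) (into (∈-lookup _)) (into (∈-lookup _)) eq)))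

-- Sorted lists and runs of equal entries.

largestPart-head : ∀ {x xs} → Linked _≥_ (x ∷ xs) → largestPart (x ∷ xs) ≡ x
largestPart-head [-]                 = refl
largestPart-head {x} (y≤x ∷ sorted) =
  trans (cong (x ⊔_) (largestPart-head sorted)) (m≥n⇒m⊔n≡m y≤x)

perimeter-head : ∀ {x xs} → Linked _≥_ (x ∷ xs) → perimeter (x ∷ xs) ≡ x + length xs
perimeter-head {x} {xs} sorted =
  cong (_∸ 1) (trans (cong (_+ suc (length xs)) (largestPart-head sorted)) (+-suc x (length xs)))

replicate-++-sorted : ∀ k {s xs} → All (_≤ s) xs → AllPairs _≥_ xs → AllPairs _≥_ (replicate k s ++ xs)
replicate-++-sorted zero    bounded sorted = sorted
replicate-++-sorted (suc k) bounded sorted =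
  ++⁺ (replicate⁺ k ≤-refl) bounded ∷ replicate-++-sorted k bounded sorted

-- Everything after the run is below `s`, so the run is the maximal prefix of copies of `s` and its
-- length can be read off.
replicate-++-injective : ∀ p q {s xs ys} → All (_< s) xs → All (_< s) ys →
  replicate p s ++ xs ≡ replicate q s ++ ys → p ≡ q × xs ≡ ys
replicate-++-injective zero    zero    _         _         eq   = refl , eq
replicate-++-injective zero    (suc q) (x<s ∷ _) _         refl = contradiction x<s (<-irrefl refl)
replicate-++-injective (suc p) zero    _         (y<s ∷ _) refl = contradiction y<s (<-irrefl refl)
replicate-++-injective (suc p) (suc q) xs<s      ys<s      eq   =
  map₁ (cong suc) (replicate-++-injective p q xs<s ys<s (∷-injectiveʳ eq))

-- Swapping the arguments makes `alternating x y (2 + t)` reduce to `alternating x y t`, so a claim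
-- of period two needs only the cases 0 and 1.
alternating : ℕ → ℕ → ℕ → ℕ
alternating x y zero    = x
alternating x y (suc t) = alternating y x t

-- The case a = suc α, d = suc δ, with suc β = d + 3 − 2a the gap between a and d + 3 − a.
module Injection (α δ β : ℕ) (2α+β≡1+δ : 2 * α + β ≡ suc δ) where

  -- The numbers congruent to ±a and their residues.

  private
    a d m : ℕ
    a = suc α
    d = suc δ
    m = d + 3

  -- Indices start at zero: `size t` is s_j with j = t + 1, so odd `t` belongs to even j. The
  -- amounts `δ` and `2 * α` are d - 1 and 2a - 2.
  step size padding topPadding : ℕ → ℕ
  step = alternating (suc β) (2 * a)

  size zero    = a
  size (suc t) = size t + step t

  padding    = alternating 0 δ
  topPadding = alternating 0 (2 * α)

  size-< : ∀ t → size t < size (suc t)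
  size-< t = m<m+n (size t) (step>0 t)
    where
    step>0 : ∀ t → 0 < step t
    step>0 zero          = s≤s z≤n
    step>0 (suc zero)    = s≤s z≤n
    step>0 (suc (suc t)) = step>0 t

  size-mono-< : ∀ {s t} → s < t → size s < size t
  size-mono-< {s} {suc t} (s≤s s≤t) with m≤n⇒m<n∨m≡n s≤t
  ... | inj₁ s<t  = <-trans (size-mono-< s<t) (size-< t)
  ... | inj₂ refl = size-< t

  size-injective : ∀ {s t} → size s ≡ size t → s ≡ t
  size-injective {s} {t} eq with <-cmp s t
  ... | tri< s<t _ _ = contradiction eq (<⇒≢ (size-mono-< s<t))
  ... | tri≈ _ s≡t _ = s≡t
  ... | tri> _ _ t<s = contradiction (sym eq) (<⇒≢ (size-mono-< t<s))

  period : suc β + 2 * a ≡ m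
  period = begin
    suc β + 2 * suc α    ≡⟨ rearrange α β ⟩
    2 * α + β + 3        ≡⟨ cong (_+ 3) 2α+β≡1+δ ⟩
    m                    ∎
    where
    open ≡-Reasoning
    rearrange : ∀ α β → suc β + 2 * suc α ≡ 2 * α + β + 3
    rearrange = solve-∀

  size-+2 : ∀ t → size (2 + t) ≡ m + size t
  size-+2 t = begin
    size t + step t + step (suc t)     ≡⟨ +-assoc (size t) _ _ ⟩
    size t + (step t + step (suc t))   ≡⟨ cong (size t +_) (steps t) ⟩
    size t + m                         ≡⟨ +-comm (size t) m ⟩
    m + size t                         ∎
    where
    open ≡-Reasoning
    steps : ∀ t → step t + step (suc t) ≡ m
    steps zero          = period
    steps (suc zero)    = trans (+-comm (2 * a) (suc β)) period
    steps (suc (suc t)) = steps t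

  -- The first two sizes are a and m - a, and two steps together add `m`. The residue -a is recorded
  -- as a sum to stay within the natural numbers.
  size-residue : ∀ t → (∃ λ k → size t ≡ k * m + a) ⊎ (∃ λ k → size t + a ≡ k * m)
  size-residue zero       = inj₁ (0 , refl)
  size-residue (suc zero) = inj₂ (1 , trans (rearrange a (suc β)) (trans period (sym (*-identityˡ m))))
    where
    rearrange : ∀ x y → x + y + x ≡ y + 2 * x
    rearrange = solve-∀
  size-residue (suc (suc t)) with size-residue t
  ... | inj₁ (k , eq) = inj₁ (suc k , (begin
    size (2 + t)      ≡⟨ size-+2 t ⟩
    m + size t        ≡⟨ cong (m +_) eq ⟩
    m + (k * m + a)   ≡⟨ +-assoc m (k * m) a ⟨
    suc k * m + a     ∎))
    where open ≡-Reasoning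
  ... | inj₂ (k , eq) = inj₂ (suc k , (begin
    size (2 + t) + a    ≡⟨ cong (_+ a) (size-+2 t) ⟩
    m + size t + a      ≡⟨ +-assoc m (size t) a ⟩
    m + (size t + a)    ≡⟨ cong (m +_) eq ⟩
    suc k * m           ∎))
    where open ≡-Reasoning

  IsSize : ℕ → Set
  IsSize x = ∃ λ t → x ≡ size t

  size-positive : ∀ {x} → IsSize x → 0 < x
  size-positive (zero  , refl) = s≤s z≤n
  size-positive (suc t , refl) = ≤-<-trans z≤n (size-< t)

  size-congruent± : ∀ {x} → IsSize x →
    (ℤ.+ x ≡ ℤ.+ a [mod m ]) ⊎ (ℤ.+ x ≡ ℤ.- (ℤ.+ a) [mod m ])
  size-congruent± (t , refl) with size-residue t
  ... | inj₁ (k , eq) = inj₁ (divides k (begin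
    ∣ ℤ.+ size t ℤ.- ℤ.+ a ∣        ≡⟨ cong (λ x → ∣ ℤ.+ x ℤ.- ℤ.+ a ∣) eq ⟩
    ∣ ℤ.+ (k * m + a) ℤ.- ℤ.+ a ∣   ≡⟨ cong ∣_∣ (ℤ.m-n≡m⊖n (k * m + a) a) ⟩
    ∣ (k * m + a) ⊖ a ∣             ≡⟨ cong ∣_∣ (ℤ.⊖-≥ (m≤n+m a (k * m))) ⟩
    k * m + a ∸ a                   ≡⟨ m+n∸n≡m (k * m) a ⟩
    k * m                           ∎))
    where open ≡-Reasoning
  -- Subtracting -a computes to adding `a`, so the absolute value is `size t + a` by definition.
  ... | inj₂ (k , eq) = inj₂ (divides k eq)

  -- Excesses and the image partition.

  lowerBound : List ℕ → ℕ
  lowerBound []      = a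
  lowerBound (y ∷ _) = y + d

  -- Each constructor stores precisely the inequality that makes the subtraction in `excess` a true
  -- difference.
  data Spaced : List ℕ → Set where
    []  : Spaced []
    _∷_ : ∀ {x xs} → lowerBound xs ≤ x → Spaced xs → Spaced (x ∷ xs)

  spaced : ∀ {xs} → Linked _≥_ xs → Linked (λ x y → x ∸ y ≥ d) xs → All (a ≤_) xs → Spaced xs
  spaced Linked.[] _ _ = []
  spaced [-] _ (a≤x ∷ _) = a≤x ∷ []
  spaced {x ∷ y ∷ _} (y≤x ∷ sorted) (d≤x∸y ∷ distinct) (_ ∷ a≤) =
    subst (_≤ x) (+-comm d y) (m≤o∸n⇒m+n≤o d y≤x d≤x∸y) ∷ spaced sorted distinct a≤

  excess : ℕ → List ℕ → ℕ
  excess x xs = x ∸ lowerBound xs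

  blocks : List ℕ → List ℕ
  blocks []       = []
  blocks (x ∷ xs) = replicate (excess x xs + padding (length xs)) (size (length xs)) ++ blocks xs

  -- The separate first copy keeps s_k in the image even when the excess and the top padding vanish;
  -- the number of parts is later recovered from it.
  image : List⁺ ℕ → List⁺ ℕ
  image (x ∷ xs) =
    size (length xs) ∷ replicate (excess x xs + topPadding (length xs)) (size (length xs)) ++ blocks xs

  blocks-< : ∀ xs → All (_< size (length xs)) (blocks xs)
  blocks-< []       = []
  blocks-< (x ∷ xs) = ++⁺ (replicate⁺ _ (size-< (length xs)))
    (All.map (λ lt → <-trans lt (size-< (length xs))) (blocks-< xs))

  blocks-size : ∀ xs → All IsSize (blocks xs)
  blocks-size []       = []
  blocks-size (x ∷ xs) = ++⁺ (replicate⁺ _ (length xs , refl)) (blocks-size xs)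

  blocks-sorted : ∀ xs → AllPairs _≥_ (blocks xs)
  blocks-sorted []       = []
  blocks-sorted (x ∷ xs) = replicate-++-sorted _ (All.map <⇒≤ (blocks-< xs)) (blocks-sorted xs)

  image-size : ∀ π → All IsSize (toList (image π))
  image-size (x ∷ xs) =
    (length xs , refl) ∷ ++⁺ (replicate⁺ _ (length xs , refl)) (blocks-size xs)

  image-sorted : ∀ π → Linked _≥_ (toList (image π))
  image-sorted (x ∷ xs) = AllPairs⇒Linked
    (replicate-++-sorted (suc _) (All.map <⇒≤ (blocks-< xs)) (blocks-sorted xs))

  image-isPartition : ∀ π → IsPartition (image π)
  image-isPartition π = image-sorted π , All.map size-positive (image-size π)

  image-congruent± : ∀ π → PartsCongruent± a m (image π)
  image-congruent± π = All.map size-congruent± (image-size π)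

  -- Preservation of the perimeter.

  length-replicate-++ : ∀ k {s : ℕ} xs → length (replicate k s ++ xs) ≡ k + length xs
  length-replicate-++ k xs = trans (length-++ (replicate k _)) (cong (_+ length xs) (length-replicate k))

  -- Compares the effect of one more part of excess 0. In the image the largest part grows by
  -- `step t`, a new top padding appears, and the old top block trades its top padding for inner
  -- padding. In the source the perimeter grows by the forced gap `d` and by one part.
  step-balance : ∀ t → step t + topPadding (suc t) + padding t ≡ suc d + topPadding t
  step-balance zero = begin
    suc β + 2 * α + 0   ≡⟨ rearrange (2 * α) β ⟩
    suc (2 * α + β) + 0 ≡⟨ cong (λ x → suc x + 0) 2α+β≡1+δ ⟩
    suc d + 0           ∎
    where
    open ≡-Reasoning
    rearrange : ∀ x y → suc y + x + 0 ≡ suc (x + y) + 0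
    rearrange = solve-∀
  step-balance (suc zero) = rearrange α δ
    where
    rearrange : ∀ x y → 2 * suc x + 0 + y ≡ suc (suc y) + 2 * x
    rearrange = solve-∀
  step-balance (suc (suc t)) = step-balance t

  -- This is the perimeter identity with subtraction cleared: `blocks (x ∷ xs)` gives its first
  -- block the inner padding where the image has the top padding, so each padding is added on the
  -- opposite side.
  length-blocks : ∀ {x xs} → Spaced (x ∷ xs) →
    length (blocks (x ∷ xs)) + size (length xs) + topPadding (length xs) ≡
      x + length xs + padding (length xs)
  length-blocks {x} {[]} (a≤x ∷ []) = begin
    length (replicate (x ∸ a + 0) a ++ []) + a + 0
      ≡⟨ cong (λ k → k + a + 0) (length-replicate-++ (x ∸ a + 0) []) ⟩
    x ∸ a + 0 + 0 + a + 0
      ≡⟨ rearrange (x ∸ a) a ⟩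
    x ∸ a + a + 0 + 0
      ≡⟨ cong (λ k → k + 0 + 0) (m∸n+n≡m a≤x) ⟩
    x + 0 + 0
      ∎
    where
    open ≡-Reasoning
    rearrange : ∀ e a → e + 0 + 0 + a + 0 ≡ e + a + 0 + 0
    rearrange = solve-∀
  -- The added `T` completes the left side of the induction hypothesis, and the added `P` that of
  -- `step-balance`.
  length-blocks {x} {y ∷ ys} (y+d≤x ∷ sp) = +-cancelʳ-≡ (T + P) _ _ (begin
    length (blocks (x ∷ y ∷ ys)) + (S + step u) + T′ + (T + P)
      ≡⟨ cong (λ k → k + (S + step u) + T′ + (T + P)) (length-replicate-++ (e + P′) (blocks (y ∷ ys))) ⟩
    e + P′ + L + (S + step u) + T′ + (T + P)
      ≡⟨ collect e P′ L S (step u) T′ T P ⟩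
    e + P′ + (L + S + T) + (step u + T′ + P)
      ≡⟨ cong₂ (λ i j → e + P′ + i + j) (length-blocks sp) (step-balance u) ⟩
    e + P′ + (y + u + P) + (suc d + T)
      ≡⟨ distribute e P′ y u P d T ⟩
    e + (y + d) + suc u + P′ + (T + P)
      ≡⟨ cong (λ k → k + suc u + P′ + (T + P)) (m∸n+n≡m y+d≤x) ⟩
    x + suc u + P′ + (T + P)
      ∎)
    where
    open ≡-Reasoning
    u e L S T T′ P P′ : ℕ
    u  = length ys
    e  = excess x (y ∷ ys)
    L  = length (blocks (y ∷ ys))
    S  = size u
    T  = topPadding u
    T′ = topPadding (suc u)
    P  = padding u
    P′ = padding (suc u)
    collect : ∀ e P′ L S s T′ T P →
      e + P′ + L + (S + s) + T′ + (T + P) ≡ e + P′ + (L + S + T) + (s + T′ + P)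
    collect = solve-∀
    distribute : ∀ e P′ y u P d T →
      e + P′ + (y + u + P) + (suc d + T) ≡ e + (y + d) + suc u + P′ + (T + P)
    distribute = solve-∀

  perimeter-image : ∀ {x xs} → Linked _≥_ (x ∷ xs) → Spaced (x ∷ xs) →
    perimeter (image (x ∷ xs)) ≡ perimeter (x ∷ xs)
  perimeter-image {x} {xs} sorted sp = begin
    perimeter (image (x ∷ xs))   ≡⟨ perimeter-head (image-sorted (x ∷ xs)) ⟩
    S + length (replicate (e + T) S ++ blocks xs)
                                 ≡⟨ cong (S +_) (length-replicate-++ (e + T) (blocks xs)) ⟩
    S + (e + T + L)              ≡⟨ +-cancelʳ-≡ P _ _ balance ⟩
    x + u                        ≡⟨ perimeter-head sorted ⟨
    perimeter (x ∷ xs)           ∎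
    where
    open ≡-Reasoning
    u e L S T P : ℕ
    u = length xs
    e = excess x xs
    L = length (blocks xs)
    S = size u
    T = topPadding u
    P = padding u
    rearrange : ∀ e L S T P → S + (e + T + L) + P ≡ e + P + L + S + T
    rearrange = solve-∀
    balance : S + (e + T + L) + P ≡ x + u + P
    balance = begin
      S + (e + T + L) + P               ≡⟨ rearrange e L S T P ⟩
      e + P + L + S + T                 ≡⟨ cong (λ k → k + S + T) (length-replicate-++ (e + P) (blocks xs)) ⟨
      length (blocks (x ∷ xs)) + S + T  ≡⟨ length-blocks sp ⟩
      x + u + P                         ∎

  -- Recovering the partition from its image.

  blocks-injective : ∀ {xs ys} → Spaced xs → Spaced ys → length xs ≡ length ys →
    blocks xs ≡ blocks ys → xs ≡ ys

  -- Serves inner blocks and the top block alike, with `c` the respective padding. Equality of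
  -- lengths is assumed because a block without excess and padding is empty, so `blocks` alone does
  -- not reveal the number of parts.
  run-injective : ∀ {x xs y ys} (c : ℕ → ℕ) → Spaced (x ∷ xs) → Spaced (y ∷ ys) → length xs ≡ length ys →
    replicate (excess x xs + c (length xs)) (size (length xs)) ++ blocks xs ≡
      replicate (excess y ys + c (length ys)) (size (length ys)) ++ blocks ys →
    x List.∷ xs ≡ y ∷ ys
  run-injective {x} {xs} {y} {ys} c (xs≤x ∷ spx) (ys≤y ∷ spy) len eq
    with replicate-++-injective _ _
           (blocks-< xs) (subst (λ t → All (_< size t) (blocks ys)) (sym len) (blocks-< ys))
           (trans eq (cong (λ t → replicate (excess y ys + c t) (size t) ++ blocks ys) (sym len)))
  -- The tails are identified first: then both lower bounds coincide, and equal run lengths give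
  -- equal first parts.
  ... | counts , rest with refl ← blocks-injective spx spy len rest =
    cong (_∷ xs) (∸-cancelʳ-≡ xs≤x ys≤y (+-cancelʳ-≡ (c (length xs)) _ _ counts))

  blocks-injective []           []           _   _  = refl
  blocks-injective spx@(_ ∷ _) spy@(_ ∷ _) len eq = run-injective padding spx spy (suc-injective len) eq

  image-injective : ∀ {π ρ} → Spaced (toList π) → Spaced (toList ρ) → image π ≡ image ρ → π ≡ ρ
  image-injective {x ∷ xs} {y ∷ ys} spx spy eq
    -- The head of the image is the size indexed by the number of remaining parts, and sizes are
    -- distinct, so the lengths agree.
    with refl ← run-injective topPadding spx spy
                  (size-injective (∷-injectiveˡ (cong toList eq))) (∷-injectiveʳ (cong toList eq)) = refl

  -- Comparison of the two counts.

  h≤ℓ : ∀ n → h d a n ≤ ℓ d a n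
  h≤ℓ n = length-≤-injection image (filter⁺ P? (partitions-unique n))
    (λ {π} → into {π}) (λ p∈ q∈ → image-injective (spaced-member p∈) (spaced-member q∈))
    where
    P? = λ π → distinct? d π ×-dec partsAtLeast? a π

    Members = List.filter P? (partitions n)

    member : ∀ {π} → π ∈ Members → (IsPartition π × perimeter π ≡ n) × Distinct d π × PartsAtLeast a π
    member π∈ with ∈-filter⁻ P? {xs = partitions n} π∈
    ... | π∈′ , conditions = Equivalence.to ∈-partitions π∈′ , conditions

    spaced-member : ∀ {π} → π ∈ Members → Spaced (toList π)
    spaced-member π∈ with ((sorted , _) , _) , distinct , a≤ ← member π∈ = spaced sorted distinct a≤

    into : ∀ {π} → π ∈ Members → image π ∈ List.filter (partsCongruent±? a m) (partitions n)
    into {π@(_ ∷ _)} π∈ with ((sorted , _) , perimeter≡n) , _ ← member π∈ =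
      ∈-filter⁺ (partsCongruent±? a m)
        (Equivalence.from ∈-partitions
          (image-isPartition π , trans (perimeter-image sorted (spaced-member π∈)) perimeter≡n))
        (image-congruent± π)

theorem1p5 : (d n a : ℕ) → 0 < d → 0 < n → 0 < a →
    2 * a < d + 3 → h d a n ≤ ℓ d a n
theorem1p5 (suc δ) n (suc α) _ _ _ 2a<d+3 = Injection.h≤ℓ α δ β gap n
  where
  β : ℕ
  -- Chosen so that `suc β` is d + 3 - 2a, the gap between the first two sizes.
  β = suc δ ∸ 2 * α

  2α≤1+δ : 2 * α ≤ suc δ
  -- Strictness of the hypothesis supplies the unit that makes this gap positive.
  2α≤1+δ = +-cancelʳ-≤ 3 _ _ (subst (_≤ suc δ + 3) (rearrange α) 2a<d+3)
    where
    rearrange : ∀ x → suc (2 * suc x) ≡ 2 * x + 3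
    rearrange = solve-∀

  gap : 2 * α + β ≡ suc δ
  gap = m+[n∸m]≡n 2α≤1+δ
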